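{- Let $n,k$ be integers with $2<2k\le n$. Suppose that the integer program $(*)$ has a solution but no trivial solution, and let $(\mathsf{u},\mathsf{v}_+,\mathsf{v}_-,r,t)$ be a (necessarily nontrivial) solution of $(*)$. Then there is a homomorphism $K_{4r+2}\to \mathrm{Pet}(n,k)^{2r+1}$ (i.e., $\mathrm{Pet}(n,k)^{2r+1}$ contains a clique on $4r+2$ vertices).
   Context: For integers $n,k$ with $2<2k\le n$, the generalized Petersen graph $\mathrm{Pet}(n,k)$ has vertex set $\{u_0,\dots,u_{n-1}\}\cup\{v_0,\dots,v_{n-1}\}$ and edge set $\{u_iu_{i+1}\}\cup\{u_iv_i\}\cup\{v_iv_{i+k}\}$, indices modulo $n$. The integer program $(*)$ is: minimize $\mathsf{u}+\mathsf{v}_++\mathsf{v}_-$ over integers $\mathsf{u},\mathsf{v}_+,\mathsf{v}_-,r\ge 0$ and $t\in\mathbb{Z}$ subject to $\mathsf{u}+k(\mathsf{v}_+-\mathsf{v}_-)=tn$ and $\mathsf{u}+\mathsf{v}_++\mathsf{v}_-=2r+1$. A solution of $(*)$ is a minimizer $(\mathsf{u},\mathsf{v}_+,\mathsf{v}_-,r,t)$; it is trivial if $\mathsf{u}=0$ or $\mathsf{v}_++\mathsf{v}_-=0$, and nontrivial otherwise. For a graph $G$ and positive integer $m$, the power graph $G^m$ has vertex set $V(G)$, two distinct vertices being adjacent iff there is a walk of length exactly $m$ between them in $G$. A homomorphism $G\to H$ is a map $V(G)\to V(H)$ sending edges to edges. -}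

module Defs where

open import Level using (0ℓ)
open import Data.Nat using (ℕ; suc; _+_; _*_; _%_; _/_; _≤_; _<_; z<s)
open import Data.Nat.DivMod using (_mod_; m≡m%n+[m/n]*n; m*n%n≡0; m<n⇒m%n≡m; m%n<n)
open import Data.Nat.Properties using (+-cancelˡ-≡; *-cancelˡ-<; *-identityˡ; *-monoˡ-<; <-≤-trans; <-trans; n<1+n; n≮n)
open import Data.Integer as ℤ using (ℤ; +_)
open import Data.Fin using (Fin; toℕ)
open import Data.Fin.Properties using (nonZeroIndex; toℕ-fromℕ<)
open import Data.Product using (Σ; _×_; _,_)
open import Data.Sum using (_⊎_)
open import Relation.Binary.Core using (Rel)
open import Relation.Binary.Definitions using (Symmetric; Irreflexive)
open import Relation.Binary.Construct.Closure.Symmetric as Sym using (SymClosure; fwd; bwd)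
open import Relation.Binary.Morphism.Structures using (IsRelHomomorphism)
open import Relation.Binary.PropositionalEquality
open import Relation.Nullary using (¬_)

record Graph : Set₁ where
  field
    Vertex     : Set
    Adj        : Rel Vertex 0ℓ
    adj-sym    : Symmetric Adj
    adj-irrefl : Irreflexive _≡_ Adj

open Graph public

Hom : Graph → Graph → Set
Hom G H = Σ (Vertex G → Vertex H) (IsRelHomomorphism (Adj G) (Adj H))

K : ℕ → Graph
K m = record
  { Vertex     = Fin m
  ; Adj        = _≢_
  ; adj-sym    = ≢-sym
  ; adj-irrefl = λ x≡y x≢y → x≢y x≡y
  }

infixr 5 _∷_

data Walk (G : Graph) : ℕ → Rel (Vertex G) 0ℓ where
  []  : ∀ {x} → Walk G 0 x x
  _∷_ : ∀ {m x y z} → Adj G x y → Walk G m y z → Walk G (suc m) x z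

module _ {G : Graph} where

  snoc : ∀ {m x y z} → Walk G m x y → Adj G y z → Walk G (suc m) x z
  snoc []      e′ = e′ ∷ []
  snoc (e ∷ w) e′ = e ∷ snoc w e′

  reverse : ∀ {m} → Symmetric (Walk G m)
  reverse []      = []
  reverse (e ∷ w) = snoc (reverse w) (adj-sym G e)

infixl 8 _^_

_^_ : Graph → ℕ → Graph
G ^ m = record
  { Vertex     = Vertex G
  ; Adj        = λ x y → x ≢ y × Walk G m x y
  ; adj-sym    = λ (x≢y , w) → ≢-sym x≢y , reverse w
  ; adj-irrefl = λ x≡y (x≢y , _) → x≢y x≡y
  }

infixl 6 _⊕_

_⊕_ : ∀ {n} → Fin n → ℕ → Fin n
_⊕_ {n} i d = (toℕ i + d) mod n
  where instance _ = nonZeroIndex i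

i⊕d≢i : ∀ {n} (i : Fin n) {d} → 0 < d → d < n → i ⊕ d ≢ i
i⊕d≢i {n} i {d} 0<d d<n i⊕d≡i = n≮n 0 (subst (0 <_) d≡0 0<d)
  where
  instance _ = nonZeroIndex i
  open ≡-Reasoning

  q : ℕ
  q = (toℕ i + d) / n

  sum%n≡i : (toℕ i + d) % n ≡ toℕ i
  sum%n≡i = trans (sym (toℕ-fromℕ< (m%n<n (toℕ i + d) n))) (cong toℕ i⊕d≡i)

  d≡q*n : d ≡ q * n
  d≡q*n = +-cancelˡ-≡ (toℕ i) d (q * n) (begin
    toℕ i + d                ≡⟨ m≡m%n+[m/n]*n (toℕ i + d) n ⟩
    (toℕ i + d) % n + q * n  ≡⟨ cong (_+ q * n) sum%n≡i ⟩
    toℕ i + q * n            ∎)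

  d≡0 : d ≡ 0
  d≡0 = begin
    d          ≡⟨ m<n⇒m%n≡m d<n ⟨
    d % n      ≡⟨ cong (_% n) d≡q*n ⟩
    q * n % n  ≡⟨ m*n%n≡0 q n ⟩
    0          ∎

data PetVertex (n : ℕ) : Set where
  u v : Fin n → PetVertex n

data PetEdge (n k : ℕ) : Rel (PetVertex n) 0ℓ where
  outer : ∀ i → PetEdge n k (u i) (u (i ⊕ 1))
  spoke : ∀ i → PetEdge n k (u i) (v i)
  inner : ∀ i → PetEdge n k (v i) (v (i ⊕ k))

module _ {n k : ℕ} (2<2k : 2 < 2 * k) (2k≤n : 2 * k ≤ n) where

  private
    1<k : 1 < k
    1<k = *-cancelˡ-< 2 1 k 2<2k

    0<k : 0 < k
    0<k = <-trans z<s 1<k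

    k<2k : ∀ k → 0 < k → k < 2 * k
    k<2k (suc k) _ = subst (_< 2 * suc k) (*-identityˡ (suc k))
                       (*-monoˡ-< (suc k) (n<1+n 1))

    k<n : k < n
    k<n = <-≤-trans (k<2k k 0<k) 2k≤n

  petEdge-irrefl : ∀ {x y} → x ≡ y → ¬ PetEdge n k x y
  petEdge-irrefl p (outer i) = i⊕d≢i i z<s (<-trans 1<k k<n) (sym (u-injective p))
    where
    u-injective : ∀ {i j : Fin n} → u i ≡ u j → i ≡ j
    u-injective refl = refl
  petEdge-irrefl () (spoke i)
  petEdge-irrefl p (inner i) = i⊕d≢i i 0<k k<n (sym (v-injective p))
    where
    v-injective : ∀ {i j : Fin n} → v i ≡ v j → i ≡ j
    v-injective refl = refl

Pet : (n k : ℕ) → 2 < 2 * k → 2 * k ≤ n → Graph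
Pet n k 2<2k 2k≤n = record
  { Vertex     = PetVertex n
  ; Adj        = SymClosure (PetEdge n k)
  ; adj-sym    = Sym.symmetric (PetEdge n k)
  ; adj-irrefl = λ where
      x≡y (fwd e) → petEdge-irrefl 2<2k 2k≤n x≡y e
      x≡y (bwd e) → petEdge-irrefl 2<2k 2k≤n (sym x≡y) e
  }

-- Membership in ℕ encodes the sign constraints of the program; only t may be
-- negative.
record Point : Set where
  constructor point
  field
    𝗎 𝗏₊ 𝗏₋ r : ℕ
    t         : ℤ

  objective : ℕ
  objective = 𝗎 + 𝗏₊ + 𝗏₋

open Point public

record Feasible (n k : ℕ) (p : Point) : Set where
  field
    winding : + 𝗎 p ℤ.+ + k ℤ.* (+ 𝗏₊ p ℤ.- + 𝗏₋ p) ≡ t p ℤ.* + n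
    parity  : 𝗎 p + 𝗏₊ p + 𝗏₋ p ≡ 2 * r p + 1

record IsSolution (n k : ℕ) (p : Point) : Set where
  field
    feasible : Feasible n k p
    minimal  : ∀ q → Feasible n k q → objective p ≤ objective q

Trivial : Point → Set
Trivial p = 𝗎 p ≡ 0 ⊎ 𝗏₊ p + 𝗏₋ p ≡ 0

{-# OPTIONS --safe #-}
-- The 2r+1 unit steps of a solution close up to a circuit through positions
-- i₀, …, i₂ᵣ of ℤ/n, and the clique consists of u and v at all of them.  Two
-- positions cut the circuit into two arcs, one odd and one even.  If they were
-- equal, the odd arc would be a smaller feasible point, so they are distinct.
-- Doing the outer steps of an arc before or after all its inner steps costs one
-- spoke between different layers and two within a layer, so the even arc
-- (resp. the odd arc) yields a walk of odd length at most 2r+1, which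
-- backtracking lengthens to exactly 2r+1.
module Submission where

open import Defs
open import Data.Bool using (Bool; true; false)
open import Data.Fin using (Fin; zero; suc; toℕ; fromℕ<; cast; remQuot; combine)
open import Data.Fin.Properties
  using (nonZeroIndex; toℕ-fromℕ<; toℕ-injective; toℕ<n; toℕ-cast; combine-remQuot)
open import Data.Integer as ℤ using (+_)
import Data.Integer.Properties as ℤ
import Data.Integer.Divisibility.Signed as Signed
import Data.Integer.Tactic.RingSolver as ℤ-Solver
open import Data.Nat
  using (ℕ; zero; suc; _+_; _*_; _∸_; _⊓_; _%_; _/_; _≤_; _<_; z<s)
open import Data.Nat.Divisibility using (_∣_; divides)
open import Data.Nat.DivMod
  using (m≡m%n+[m/n]*n; m%n<n; m<n⇒m%n≡m; %-distribˡ-+; m%n%n≡m%n; [m+kn]%n≡m%n)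
open import Data.Nat.Properties
open import Data.Nat.Tactic.RingSolver using (solve-∀)
open import Data.Product using (∃-syntax; _×_; _,_; proj₁; proj₂)
open import Data.Sum using (_⊎_; inj₁; inj₂)
open import Function using (_∘_)
open import Relation.Binary.Construct.Closure.Symmetric using (fwd; bwd)
open import Relation.Binary.Definitions using (tri<; tri≈; tri>)
open import Relation.Binary.PropositionalEquality
open import Relation.Nullary using (¬_; contradiction)

-- Walks

infixr 5 _++_

_++_ : ∀ {G l m x y z} → Walk G l x y → Walk G m y z → Walk G (l + m) x z
[]      ++ w′ = w′
(e ∷ w) ++ w′ = e ∷ (w ++ w′)

resize : ∀ {G l m x y} → l ≡ m → Walk G l x y → Walk G m x y
resize {G} {x = x} {y} = subst (λ l → Walk G l x y)

-- Going back and forth along the first edge adds two to the length. The source length is a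
-- successor so that such an edge exists.
lengthen : ∀ {G m x y} j → Walk G (suc m) x y → Walk G (2 * j + suc m) x y
lengthen             zero    w = w
lengthen {m = m} (suc j) w =
  resize (eq j m) (backtrack (resize (+-suc (2 * j) m) (lengthen j w)))
  where
  backtrack : ∀ {G m x y} → Walk G (suc m) x y → Walk G (3 + m) x y
  backtrack {G} (e ∷ w) = e ∷ adj-sym G e ∷ e ∷ w

  eq : ∀ j m → 3 + (2 * j + m) ≡ 2 * suc j + suc m
  eq = solve-∀

-- Translations of ℤ/n

module _ {n : ℕ} where

  ⊕-assoc : ∀ (i : Fin n) d e → i ⊕ d ⊕ e ≡ i ⊕ (d + e)
  ⊕-assoc i d e = toℕ-injective (begin
    toℕ (i ⊕ d ⊕ e)                        ≡⟨ toℕ-fromℕ< _ ⟩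
    (toℕ (i ⊕ d) + e) % n                  ≡⟨ cong (λ x → (x + e) % n) (toℕ-fromℕ< _) ⟩
    ((toℕ i + d) % n + e) % n              ≡⟨ %-distribˡ-+ ((toℕ i + d) % n) e n ⟩
    ((toℕ i + d) % n % n + e % n) % n      ≡⟨ cong (λ x → (x + e % n) % n) (m%n%n≡m%n (toℕ i + d) n) ⟩
    ((toℕ i + d) % n + e % n) % n          ≡⟨ %-distribˡ-+ (toℕ i + d) e n ⟨
    (toℕ i + d + e) % n                    ≡⟨ cong (_% n) (+-assoc (toℕ i) d e) ⟩
    (toℕ i + (d + e)) % n                  ≡⟨ toℕ-fromℕ< _ ⟨
    toℕ (i ⊕ (d + e))                      ∎)
    where
    open ≡-Reasoning
    instance _ = nonZeroIndex i

  ∣⇒⊕-fixed : ∀ (i : Fin n) {d} → n ∣ d → i ⊕ d ≡ i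
  ∣⇒⊕-fixed i (divides q refl) = toℕ-injective (begin
    toℕ (i ⊕ (q * n))    ≡⟨ toℕ-fromℕ< _ ⟩
    (toℕ i + q * n) % n  ≡⟨ [m+kn]%n≡m%n (toℕ i) q n ⟩
    toℕ i % n            ≡⟨ m<n⇒m%n≡m (toℕ<n i) ⟩
    toℕ i                ∎)
    where
    open ≡-Reasoning
    instance _ = nonZeroIndex i

  ⊕-identityʳ : ∀ (i : Fin n) → i ⊕ 0 ≡ i
  ⊕-identityʳ i = ∣⇒⊕-fixed i (divides 0 refl)

  ⊕-fixed⇒∣ : ∀ (i : Fin n) {d} → i ⊕ d ≡ i → n ∣ d
  ⊕-fixed⇒∣ i {d} i⊕d≡i = divides q (+-cancelˡ-≡ (toℕ i) d (q * n) (begin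
    toℕ i + d                ≡⟨ m≡m%n+[m/n]*n (toℕ i + d) n ⟩
    (toℕ i + d) % n + q * n  ≡⟨ cong (_+ q * n) (toℕ-fromℕ< _) ⟨
    toℕ (i ⊕ d) + q * n      ≡⟨ cong (λ j → toℕ j + q * n) i⊕d≡i ⟩
    toℕ i + q * n            ∎))
    where
    open ≡-Reasoning
    instance _ = nonZeroIndex i
    q = (toℕ i + d) / n

  translates : ∀ {G} (x : Fin n → Vertex G) d → (∀ i → Adj G (x i) (x (i ⊕ d))) →
               ∀ m i → Walk G m (x i) (x (i ⊕ m * d))
  translates {G} x d step zero    i = subst (λ j → Walk G 0 (x i) (x j)) (sym (⊕-identityʳ i)) []
  translates {G} x d step (suc m) i =
    step i ∷ subst (λ j → Walk G m _ (x j)) (⊕-assoc i d (m * d)) (translates {G} x d step m (i ⊕ d))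

-- Numbers of steps

record Steps : Set where
  constructor steps
  field
    outward forward backward : ℕ

  size : ℕ
  size = outward + forward + backward

open Steps

infixl 6 _∙_

_∙_ : Steps → Steps → Steps
steps a b c ∙ steps a′ b′ c′ = steps (a + a′) (b + b′) (c + c′)

record _⊑_ (σ τ : Steps) : Set where
  constructor ⊑-intro
  field
    outward≤  : outward σ ≤ outward τ
    forward≤  : forward σ ≤ forward τ
    backward≤ : backward σ ≤ backward τ

-- Componentwise subtraction is exact under `σ ⊑ τ`. The witness serves as the arc that leads from
-- one prefix of the circuit to a later stage.
⊑⇒∙ : ∀ {σ τ} → σ ⊑ τ → ∃[ ρ ] σ ∙ ρ ≡ τ
⊑⇒∙ {steps a b c} {steps a′ b′ c′} (⊑-intro a≤a′ b≤b′ c≤c′) =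
  steps (a′ ∸ a) (b′ ∸ b) (c′ ∸ c) ,
  trans (cong (λ x → steps x _ _) (m+[n∸m]≡n a≤a′))
        (cong₂ (steps a′) (m+[n∸m]≡n b≤b′) (m+[n∸m]≡n c≤c′))

size-∙ : ∀ σ τ → size (σ ∙ τ) ≡ size σ + size τ
size-∙ (steps a b c) (steps a′ b′ c′) = lemma a b c a′ b′ c′
  where
  lemma : ∀ a b c a′ b′ c′ → (a + a′) + (b + b′) + (c + c′) ≡ (a + b + c) + (a′ + b′ + c′)
  lemma = solve-∀

-- This fixes the order of the circuit: outward steps, then forward, then backward. The last
-- component is not capped, so a prefix has size `s` for every `s`; `prefix-⊑` bounds it by
-- `s ≤ size τ`.
prefix : Steps → ℕ → Steps
prefix (steps a b c) s = steps (a ⊓ s) (b ⊓ (s ∸ a)) (s ∸ a ∸ b)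

size-prefix : ∀ τ s → size (prefix τ s) ≡ s
size-prefix (steps a b c) s = begin
  a ⊓ s + b ⊓ (s ∸ a) + (s ∸ a ∸ b)    ≡⟨ +-assoc (a ⊓ s) _ _ ⟩
  a ⊓ s + (b ⊓ (s ∸ a) + (s ∸ a ∸ b))  ≡⟨ cong (_+_ (a ⊓ s)) (m⊓n+n∸m≡n b (s ∸ a)) ⟩
  a ⊓ s + (s ∸ a)                      ≡⟨ m⊓n+n∸m≡n a s ⟩
  s                                    ∎
  where open ≡-Reasoning

prefix-mono : ∀ τ {s t} → s ≤ t → prefix τ s ⊑ prefix τ t
prefix-mono (steps a b c) s≤t = ⊑-intro
  (⊓-monoʳ-≤ a s≤t)
  (⊓-monoʳ-≤ b (∸-monoˡ-≤ a s≤t))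
  (∸-monoˡ-≤ b (∸-monoˡ-≤ a s≤t))

prefix-⊑ : ∀ τ {s} → s ≤ size τ → prefix τ s ⊑ τ
prefix-⊑ (steps a b c) {s} s≤ = ⊑-intro
  (m⊓n≤m a s)
  (m⊓n≤m b (s ∸ a))
  (m≤n+o⇒m∸n≤o _ b (m≤n+o⇒m∸n≤o _ a (≤-trans s≤ (≤-reflexive (+-assoc a b c)))))

-- Induction takes two off `a` at a time. The equation `x + y ≡ r` shows how the halves share `r`;
-- it later bounds the odd arc and counts the backtracks.
odd-sum : ∀ a b r → a + b ≡ 2 * r + 1 →
          (∃[ x ] ∃[ y ] a ≡ 2 * x + 1 × b ≡ 2 * y × x + y ≡ r) ⊎
          (∃[ x ] ∃[ y ] b ≡ 2 * x + 1 × a ≡ 2 * y × x + y ≡ r)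
odd-sum zero          b r       eq = inj₂ (r , 0 , eq , refl , +-identityʳ r)
odd-sum (suc zero)    b r       eq =
  inj₁ (0 , r , refl , suc-injective (trans eq (+-comm (2 * r) 1)) , refl)
odd-sum (suc (suc a)) b zero    ()
odd-sum (suc (suc a)) b (suc r) eq
  with odd-sum a b r (+-cancelˡ-≡ 2 _ _ (trans eq (double r)))
  where
  double : ∀ r → 2 * suc r + 1 ≡ 2 + (2 * r + 1)
  double = solve-∀
... | inj₁ (x , y , p , q , e) =
  inj₁ (suc x , y , trans (cong (λ z → suc (suc z)) p) (lemma x) , q , cong suc e)
  where
  lemma : ∀ x → 2 + (2 * x + 1) ≡ 2 * suc x + 1
  lemma = solve-∀
... | inj₂ (x , y , p , q , e) =
  inj₂ (x , suc y , p , trans (cong (λ z → suc (suc z)) q) (lemma y) , trans (+-suc x y) (cong suc e))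
  where
  lemma : ∀ y → 2 + 2 * y ≡ 2 * suc y
  lemma = solve-∀

-- Displacements and the winding constraint

module _ (n k : ℕ) (2<2k : 2 < 2 * k) (2k≤n : 2 * k ≤ n) where

  private
    P : Graph
    P = Pet n k 2<2k 2k≤n

    k≤n : k ≤ n
    k≤n = ≤-trans (m≤m+n k (k + 0)) 2k≤n

    0<n : 0 < n
    0<n = <-≤-trans z<s (≤-trans 2<2k 2k≤n)

  -- A step of −k is counted as n ∸ k, so that positions never leave ℕ.
  displacement : Steps → ℕ
  displacement (steps a b c) = a + b * k + c * (n ∸ k)

  displacement-∙ : ∀ σ τ → displacement (σ ∙ τ) ≡ displacement σ + displacement τ
  displacement-∙ (steps a b c) (steps a′ b′ c′) = lemma a b c a′ b′ c′ k (n ∸ k)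
    where
    lemma : ∀ a b c a′ b′ c′ k m → (a + a′) + (b + b′) * k + (c + c′) * m
                                 ≡ (a + b * k + c * m) + (a′ + b′ * k + c′ * m)
    lemma = solve-∀

  -- Each backward step contributes `n ∸ k` in place of `- k`, an excess of `n`; hence the
  -- correction term `backward τ * n`.
  displacement-winding : ∀ τ → + displacement τ ≡
    + outward τ ℤ.+ + k ℤ.* (+ forward τ ℤ.- + backward τ) ℤ.+ + backward τ ℤ.* + n
  displacement-winding (steps a b c) = begin
    + (a + b * k + c * (n ∸ k))                             ≡⟨⟩
    + a ℤ.+ + (b * k) ℤ.+ + (c * (n ∸ k))                   ≡⟨ cong₂ (λ x y → + a ℤ.+ x ℤ.+ y) (ℤ.pos-* b k) (ℤ.pos-* c (n ∸ k)) ⟩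
    + a ℤ.+ + b ℤ.* + k ℤ.+ + c ℤ.* + (n ∸ k)               ≡⟨ lemma (+ a) (+ b) (+ c) (+ k) (+ (n ∸ k)) ⟩
    + a ℤ.+ + k ℤ.* (+ b ℤ.- + c) ℤ.+ + c ℤ.* + (k + (n ∸ k)) ≡⟨ cong (λ x → + a ℤ.+ + k ℤ.* (+ b ℤ.- + c) ℤ.+ + c ℤ.* + x) (m+[n∸m]≡n k≤n) ⟩
    + a ℤ.+ + k ℤ.* (+ b ℤ.- + c) ℤ.+ + c ℤ.* + n           ∎
    where
    open ≡-Reasoning
    lemma : ∀ a b c k m → a ℤ.+ b ℤ.* k ℤ.+ c ℤ.* m ≡ a ℤ.+ k ℤ.* (b ℤ.- c) ℤ.+ c ℤ.* (k ℤ.+ m)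
    lemma = ℤ-Solver.solve-∀

  feasible⇒∣ : ∀ {p} → Feasible n k p → n ∣ displacement (steps (𝗎 p) (𝗏₊ p) (𝗏₋ p))
  -- The quotient is `t` from the winding equation plus one for each backward step, whose encoding
  -- adds `n`.
  feasible⇒∣ {p} f = Signed.∣⇒∣ᵤ (Signed.divides (t p ℤ.+ + 𝗏₋ p) (begin
    + displacement (steps (𝗎 p) (𝗏₊ p) (𝗏₋ p))  ≡⟨ displacement-winding (steps (𝗎 p) (𝗏₊ p) (𝗏₋ p)) ⟩
    + 𝗎 p ℤ.+ + k ℤ.* (+ 𝗏₊ p ℤ.- + 𝗏₋ p) ℤ.+ + 𝗏₋ p ℤ.* + n
                                                ≡⟨ cong (ℤ._+ + 𝗏₋ p ℤ.* + n) (Feasible.winding f) ⟩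
    t p ℤ.* + n ℤ.+ + 𝗏₋ p ℤ.* + n              ≡⟨ ℤ.*-distribʳ-+ (+ n) (t p) (+ 𝗏₋ p) ⟨
    (t p ℤ.+ + 𝗏₋ p) ℤ.* + n                    ∎))
    where open ≡-Reasoning

  -- Turns a closed arc of odd size into a competitor for minimality; the excess turns from backward
  -- steps are subtracted from the quotient to recover `t`.
  ∣⇒feasible : ∀ τ {x} → size τ ≡ 2 * x + 1 → n ∣ displacement τ →
               ∃[ t ] Feasible n k (point (outward τ) (forward τ) (backward τ) x t)
  ∣⇒feasible τ {x} odd (divides q eq) = + q ℤ.- + backward τ , record
    { winding = begin
        w                                              ≡⟨ cancel w (+ backward τ ℤ.* + n) ⟩
        w ℤ.+ + backward τ ℤ.* + n ℤ.- + backward τ ℤ.* + n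
                                                       ≡⟨ cong (ℤ._- + backward τ ℤ.* + n) (displacement-winding τ) ⟨
        + displacement τ ℤ.- + backward τ ℤ.* + n      ≡⟨ cong (λ d → + d ℤ.- + backward τ ℤ.* + n) eq ⟩
        + (q * n) ℤ.- + backward τ ℤ.* + n             ≡⟨ cong (ℤ._- + backward τ ℤ.* + n) (ℤ.pos-* q n) ⟩
        + q ℤ.* + n ℤ.- + backward τ ℤ.* + n           ≡⟨ distrib (+ q) (+ backward τ) (+ n) ⟩
        (+ q ℤ.- + backward τ) ℤ.* + n                 ∎
    ; parity = odd
    }
    where
    open ≡-Reasoning
    w = + outward τ ℤ.+ + k ℤ.* (+ forward τ ℤ.- + backward τ)
    cancel : ∀ x y → x ≡ x ℤ.+ y ℤ.- y
    cancel = ℤ-Solver.solve-∀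
    distrib : ∀ x y z → x ℤ.* z ℤ.- y ℤ.* z ≡ (x ℤ.- y) ℤ.* z
    distrib = ℤ-Solver.solve-∀

  -- Walks in the Petersen graph

  layer : Bool → Fin n → PetVertex n
  layer false = u
  layer true  = v

  layer-injective : ∀ ℓ {i j} → layer ℓ i ≡ layer ℓ j → i ≡ j
  layer-injective false refl = refl
  layer-injective true  refl = refl

  outerWalk : ∀ a i → Walk P a (u i) (u (i ⊕ a))
  outerWalk a i = subst (λ d → Walk P a (u i) (u (i ⊕ d))) (*-identityʳ a)
                    (translates {G = P} u 1 (fwd ∘ outer) a i)

  innerWalk : ∀ b c i → Walk P (b + c) (v i) (v (i ⊕ (b * k + c * (n ∸ k))))
  innerWalk b c i = subst (λ j → Walk P (b + c) (v i) (v j)) (⊕-assoc i (b * k) (c * (n ∸ k)))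
    (translates {G = P} v k (fwd ∘ inner) b i ++ translates {G = P} v (n ∸ k) back c (i ⊕ b * k))
    where
    -- Since `(n ∸ k) + k` is `n`, the inner edge starting at `i ⊕ (n ∸ k)` ends at `i`; it is
    -- traversed backwards.
    back : ∀ i → Adj P (v i) (v (i ⊕ (n ∸ k)))
    back i = subst (λ j → Adj P (v j) (v (i ⊕ (n ∸ k))))
      (trans (⊕-assoc i (n ∸ k) k) (∣⇒⊕-fixed i (divides 1 (trans (m∸n+n≡m k≤n) (sym (*-identityˡ n))))))
      (bwd (inner (i ⊕ (n ∸ k))))

  -- Translations commute, so the steps may be regrouped: all outer ones first, one spoke, then all
  -- inner ones. `crossWalk-vu` uses the opposite order.
  crossWalk-uv : ∀ τ i → Walk P (1 + size τ) (u i) (v (i ⊕ displacement τ))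
  crossWalk-uv (steps a b c) i =
    subst₂ (λ m j → Walk P m (u i) (v j)) (eq a b c)
      (trans (⊕-assoc i a _) (cong (i ⊕_) (sym (+-assoc a _ _))))
      (outerWalk a i ++ fwd (spoke _) ∷ innerWalk b c (i ⊕ a))
    where
    eq : ∀ a b c → a + suc (b + c) ≡ 1 + (a + b + c)
    eq = solve-∀

  crossWalk-vu : ∀ τ i → Walk P (1 + size τ) (v i) (u (i ⊕ displacement τ))
  crossWalk-vu (steps a b c) i =
    subst₂ (λ m j → Walk P m (v i) (u j)) (eq a b c)
      (trans (⊕-assoc i _ a) (cong (i ⊕_) (rearrange a (b * k) (c * (n ∸ k)))))
      (innerWalk b c i ++ bwd (spoke _) ∷ outerWalk a _)
    where
    eq : ∀ a b c → b + c + suc a ≡ 1 + (a + b + c)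
    eq = solve-∀
    rearrange : ∀ x y z → y + z + x ≡ x + y + z
    rearrange = solve-∀

  -- Within a layer, `σ` and two spokes give length `2x + 3`; across layers, `τ` and one spoke give
  -- `2y + 3`. As `r` is `x + y + 1`, the missing lengths are `2y` and `2x`, filled by backtracking.
  arcs⇒walk : ∀ {r x y i j} σ τ → size σ ≡ 2 * x + 1 → size τ ≡ 2 * suc y → x + suc y ≡ r →
              i ⊕ displacement σ ≡ j → j ⊕ displacement τ ≡ i →
              ∀ ℓ ℓ′ → Walk P (2 * r + 1) (layer ℓ i) (layer ℓ′ j)
  arcs⇒walk {_} {x} {y} {i} σ τ |σ| |τ| refl refl back = walk
    where
    j = i ⊕ displacement σ

    within : ∀ {z w} → Walk P (suc (suc (size σ))) z w → Walk P (2 * (x + suc y) + 1) z w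
    within w = resize (trans (cong (λ m → 2 * y + (2 + m)) |σ|) (eq x y))
                 (lengthen {P} y w)
      where
      eq : ∀ x y → 2 * y + (2 + (2 * x + 1)) ≡ 2 * (x + suc y) + 1
      eq = solve-∀

    across : ∀ {z w} → Walk P (suc (size τ)) z w → Walk P (2 * (x + suc y) + 1) z w
    across w = resize (trans (cong (λ m → 2 * x + suc m) |τ|) (eq x y))
                 (lengthen {P} x w)
      where
      eq : ∀ x y → 2 * x + suc (2 * suc y) ≡ 2 * (x + suc y) + 1
      eq = solve-∀

    walk : ∀ ℓ ℓ′ → Walk P (2 * (x + suc y) + 1) (layer ℓ i) (layer ℓ′ j)
    walk false false = within (snoc (crossWalk-uv σ i) (bwd (spoke j)))
    walk true  true  = within (bwd (spoke i) ∷ crossWalk-uv σ i)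
    -- The arc `τ` leads from `j` to `i`, so the walk is built in that direction and reversed.
    walk false true  = across (reverse (subst (λ h → Walk P _ (v j) (u h)) back (crossWalk-vu τ j)))
    walk true  false = across (reverse (subst (λ h → Walk P _ (u j) (v h)) back (crossWalk-uv τ j)))

  -- Positions on the circuit of a solution

  module _ {p : Point} (sol : IsSolution n k p) where

    open IsSolution sol

    private
      total : Steps
      total = steps (𝗎 p) (𝗏₊ p) (𝗏₋ p)

      L : ℕ
      L = 2 * r p + 1

      origin : Fin n
      origin = fromℕ< 0<n

    position : ℕ → Fin n
    position s = origin ⊕ displacement (prefix total s)

    -- Minimality enters here: a closed arc of size `2x + 1` would be feasible with an objective
    -- below `2r + 1`.
    short-odd-displaces : ∀ {x} → x < r p → ∀ τ → size τ ≡ 2 * x + 1 → ∀ i → i ⊕ displacement τ ≢ i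
    short-odd-displaces {x} x<r τ odd i fixed =
      <⇒≱ (subst₂ _<_ (sym odd) (sym (Feasible.parity feasible)) (+-monoˡ-< 1 (*-monoʳ-< 2 x<r)))
          (minimal _ (proj₂ (∣⇒feasible τ {x} odd (⊕-fixed⇒∣ i fixed))))

    position-∙ : ∀ {s t} σ → prefix total s ∙ σ ≡ prefix total t →
                 position s ⊕ displacement σ ≡ position t
    position-∙ {s} {t} σ eq = begin
      position s ⊕ displacement σ                               ≡⟨ ⊕-assoc origin (displacement (prefix total s)) _ ⟩
      origin ⊕ (displacement (prefix total s) + displacement σ) ≡⟨ cong (origin ⊕_) (displacement-∙ (prefix total s) σ) ⟨
      origin ⊕ displacement (prefix total s ∙ σ)                ≡⟨ cong (λ τ → origin ⊕ displacement τ) eq ⟩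
      position t                                                ∎
      where open ≡-Reasoning

    -- The arc `ρ` completes the circuit, whose displacement is a multiple of `n` by feasibility;
    -- from the origin the prefix then leads to `position s`.
    position-wrap : ∀ {s t} ρ → prefix total t ∙ ρ ≡ total →
                    position t ⊕ displacement (ρ ∙ prefix total s) ≡ position s
    position-wrap {s} {t} ρ eq = begin
      position t ⊕ displacement (ρ ∙ prefix total s)   ≡⟨ cong (position t ⊕_) (displacement-∙ ρ (prefix total s)) ⟩
      position t ⊕ (displacement ρ + dₛ)               ≡⟨ ⊕-assoc (position t) (displacement ρ) dₛ ⟨
      position t ⊕ displacement ρ ⊕ dₛ                 ≡⟨ cong (_⊕ dₛ) (⊕-assoc origin (displacement (prefix total t)) (displacement ρ)) ⟩
      origin ⊕ (displacement (prefix total t) + displacement ρ) ⊕ dₛ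
                                                       ≡⟨ cong (λ d → origin ⊕ d ⊕ dₛ) (displacement-∙ (prefix total t) ρ) ⟨
      origin ⊕ displacement (prefix total t ∙ ρ) ⊕ dₛ  ≡⟨ cong (λ τ → origin ⊕ displacement τ ⊕ dₛ) eq ⟩
      origin ⊕ displacement total ⊕ dₛ                 ≡⟨ cong (_⊕ dₛ) (∣⇒⊕-fixed origin (feasible⇒∣ feasible)) ⟩
      position s                                       ∎
      where
      open ≡-Reasoning
      dₛ = displacement (prefix total s)

    arcs : ∀ {s t} → s < t → t < L → ∃[ σ ] ∃[ τ ]
           size σ + size τ ≡ L × 0 < size σ × 0 < size τ ×
           position s ⊕ displacement σ ≡ position t ×
           position t ⊕ displacement τ ≡ position s
    arcs {s} {t} s<t t<L
      with ⊑⇒∙ (prefix-mono total (<⇒≤ s<t))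
         | ⊑⇒∙ (prefix-⊑ total (<⇒≤ (subst (t <_) (sym (Feasible.parity feasible)) t<L)))
    ... | σ , σ-eq | ρ , ρ-eq =
      σ , τ , +-cancelˡ-≡ s _ _ sum , 0<σ , 0<τ , position-∙ {s} {t} σ σ-eq , position-wrap {s} {t} ρ ρ-eq
      where
      open ≡-Reasoning
      τ = ρ ∙ prefix total s

      s+σ≡t : s + size σ ≡ t
      s+σ≡t = begin
        s + size σ                        ≡⟨ cong (_+ size σ) (size-prefix total s) ⟨
        size (prefix total s) + size σ    ≡⟨ size-∙ (prefix total s) σ ⟨
        size (prefix total s ∙ σ)         ≡⟨ cong size σ-eq ⟩
        size (prefix total t)             ≡⟨ size-prefix total t ⟩
        t                                 ∎

      t+ρ≡L : t + size ρ ≡ L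
      t+ρ≡L = begin
        t + size ρ                        ≡⟨ cong (_+ size ρ) (size-prefix total t) ⟨
        size (prefix total t) + size ρ    ≡⟨ size-∙ (prefix total t) ρ ⟨
        size (prefix total t ∙ ρ)         ≡⟨ cong size ρ-eq ⟩
        size total                        ≡⟨ Feasible.parity feasible ⟩
        L                                 ∎

      τ≡ρ+s : size τ ≡ size ρ + s
      τ≡ρ+s = trans (size-∙ ρ (prefix total s)) (cong (_+_ (size ρ)) (size-prefix total s))

      -- Adding `s` to both sides lets the lengths telescope through `t` without subtraction.
      sum : s + (size σ + size τ) ≡ s + L
      sum = begin
        s + (size σ + size τ)        ≡⟨ +-assoc s (size σ) (size τ) ⟨
        s + size σ + size τ          ≡⟨ cong₂ _+_ s+σ≡t τ≡ρ+s ⟩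
        t + (size ρ + s)             ≡⟨ +-assoc t (size ρ) s ⟨
        t + size ρ + s               ≡⟨ cong (_+ s) t+ρ≡L ⟩
        L + s                        ≡⟨ +-comm L s ⟩
        s + L                        ∎

      0<σ : 0 < size σ
      0<σ = +-cancelˡ-< s 0 _ (subst₂ _<_ (sym (+-identityʳ s)) (sym s+σ≡t) s<t)

      0<τ : 0 < size τ
      0<τ = subst (0 <_) (sym τ≡ρ+s)
        (<-≤-trans (+-cancelˡ-< t 0 _ (subst₂ _<_ (sym (+-identityʳ t)) (sym t+ρ≡L) t<L)) (m≤m+n (size ρ) s))

    -- Adjacency in the power graph

    positions-adjacent : ∀ {s t} → s < t → t < L → ∀ ℓ ℓ′ →
                         Adj (P ^ L) (layer ℓ (position s)) (layer ℓ′ (position t))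
    positions-adjacent {s} {t} s<t t<L ℓ ℓ′ = layer-≢ ℓ ℓ′ , proj₂ split ℓ ℓ′
      where
      -- The even arc has positive half `suc y`, so the odd arc is strictly shorter than the
      -- circuit.
      x<r : ∀ {x y} → x + suc y ≡ r p → x < r p
      x<r {x} {y} eq = subst (x <_) eq (m<m+n x z<s)

      split : position s ≢ position t ×
              (∀ ℓ ℓ′ → Walk P L (layer ℓ (position s)) (layer ℓ′ (position t)))
      split with arcs s<t t<L
      ... | σ , τ , sum , 0<σ , 0<τ , there , back with odd-sum (size σ) (size τ) (r p) sum
      -- A zero half would make the even arc empty, but both arcs are nonempty.
      ... | inj₁ (x , zero  , |σ| , |τ| , _) = contradiction (sym |τ|) (<⇒≢ 0<τ)
      ... | inj₁ (x , suc y , |σ| , |τ| , eq) =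
        (λ s≡t → short-odd-displaces (x<r eq) σ |σ| _ (trans there (sym s≡t))) ,
        arcs⇒walk σ τ |σ| |τ| eq there back
      ... | inj₂ (x , zero  , |τ| , |σ| , _) = contradiction (sym |σ|) (<⇒≢ 0<σ)
      ... | inj₂ (x , suc y , |τ| , |σ| , eq) =
        (λ s≡t → short-odd-displaces (x<r eq) τ |τ| _ (trans back s≡t)) ,
        -- Here the odd arc runs from `position t` to `position s`, so endpoints and layers are
        -- exchanged and the walk is reversed.
        λ ℓ ℓ′ → reverse (arcs⇒walk τ σ |τ| |σ| eq back there ℓ′ ℓ)

      layer-≢ : ∀ ℓ ℓ′ → layer ℓ (position s) ≢ layer ℓ′ (position t)
      layer-≢ false false = proj₁ split ∘ layer-injective false
      layer-≢ true  true  = proj₁ split ∘ layer-injective true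
      layer-≢ false true  ()
      layer-≢ true  false ()

    -- A single spoke has length 1, and `r` backtracks bring it to `2r + 1`.
    rung-adjacent : ∀ i {ℓ ℓ′} → ℓ ≢ ℓ′ → Adj (P ^ L) (layer ℓ i) (layer ℓ′ i)
    rung-adjacent i {false} {false} ℓ≢ℓ′ = contradiction refl ℓ≢ℓ′
    rung-adjacent i {true}  {true}  ℓ≢ℓ′ = contradiction refl ℓ≢ℓ′
    rung-adjacent i {false} {true}  _    = (λ ()) , lengthen {P} (r p) (fwd (spoke i) ∷ [])
    rung-adjacent i {true}  {false} _    = (λ ()) , lengthen {P} (r p) (bwd (spoke i) ∷ [])

    rungs-clique : ∀ {s t ℓ ℓ′} → s < L → t < L → (ℓ , s) ≢ (ℓ′ , t) →
                   Adj (P ^ L) (layer ℓ (position s)) (layer ℓ′ (position t))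
    rungs-clique {s} {t} {ℓ} {ℓ′} s<L t<L ≢ with <-cmp s t
    ... | tri< s<t _ _ = positions-adjacent s<t t<L ℓ ℓ′
    ... | tri≈ _ refl _ = rung-adjacent (position s) (≢ ∘ cong (_, s))
    ... | tri> _ _ t<s = adj-sym (P ^ L) {layer ℓ′ (position t)} (positions-adjacent t<s s<L ℓ′ ℓ)

-- Indexing the clique by pairs of a layer and a position

theorem3 : (n k : ℕ) (2<2k : 2 < 2 * k) (2k≤n : 2 * k ≤ n) →
    (∀ q → IsSolution n k q → ¬ Trivial q) →
    (p : Point) → IsSolution n k p →
    Hom (K (4 * r p + 2)) (Pet n k 2<2k 2k≤n ^ (2 * r p + 1))
theorem3 n k 2<2k 2k≤n _ p sol = f , record
  { cong = λ {i} {j} i≢j → rungs-clique n k 2<2k 2k≤n sol (toℕ<n _) (toℕ<n _) (i≢j ∘ code-injective i j) }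
  where
  L = 2 * r p + 1

  eq : ∀ r → 4 * r + 2 ≡ 2 * (2 * r + 1)
  eq = solve-∀

  pair : Fin (4 * r p + 2) → Fin 2 × Fin L
  pair i = remQuot L (cast (eq (r p)) i)

  bit : Fin 2 → Bool
  bit zero    = false
  bit (suc _) = true

  bit-injective : ∀ x y → bit x ≡ bit y → x ≡ y
  bit-injective zero       zero       _ = refl
  bit-injective (suc zero) (suc zero) _ = refl

  code : Fin (4 * r p + 2) → Bool × ℕ
  code i = bit (proj₁ (pair i)) , toℕ (proj₂ (pair i))

  f : Fin (4 * r p + 2) → PetVertex n
  f i = layer n k 2<2k 2k≤n (proj₁ (code i)) (position n k 2<2k 2k≤n sol (proj₂ (code i)))

  -- Distinctness is needed only for codes: `rungs-clique` turns distinct codes into adjacent, hence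
  -- distinct, vertices.
  code-injective : ∀ i j → code i ≡ code j → i ≡ j
  code-injective i j e = toℕ-injective (begin
    toℕ i                                   ≡⟨ toℕ-cast (eq (r p)) i ⟨
    toℕ (cast (eq (r p)) i)                 ≡⟨ cong toℕ (combine-remQuot {2} L _) ⟨
    toℕ (combine (proj₁ (pair i)) (proj₂ (pair i)))
      ≡⟨ cong toℕ (cong₂ combine (bit-injective _ _ (cong proj₁ e)) (toℕ-injective (cong proj₂ e))) ⟩
    toℕ (combine (proj₁ (pair j)) (proj₂ (pair j)))
                                            ≡⟨ cong toℕ (combine-remQuot {2} L _) ⟩
    toℕ (cast (eq (r p)) j)                 ≡⟨ toℕ-cast (eq (r p)) j ⟩
    toℕ j                                   ∎)
    where open ≡-Reasoning
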